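{- Let $G$ be a traceable graph and let $\ell$ be a positive integer. Then $pc_{1,\ell}(G)\leq \ell+1$. In particular, $pc_{1,2}(G)\leq 3$.
   Context: All graphs are finite, undirected, simple and connected. A graph is traceable if it contains a Hamiltonian path. An edge-coloring of a graph is an arbitrary map from its edge set to the natural numbers (adjacent edges may share a color). In an edge-colored graph, a path $P$ is a distance $\ell$-proper path if no two edges of $P$ of the same color appear with fewer than $\ell$ edges in between on $P$. The number $pc_{1,\ell}(G)$ is the minimum number of colors in an edge-coloring of $G$ such that every pair of distinct vertices of $G$ is connected by at least one distance $\ell$-proper path. -}

module Defs where

open import Level using (0ℓ)
open import Data.Nat using (ℕ; zero; suc; _∸_; _*_; _^_; _⊔_; _≤_; _<_; z≤n; s≤s; _<?_; _≟_)
import Data.Nat.Properties as ℕ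
open import Data.Nat.Induction using (<-wellFounded)
open import Induction.WellFounded using (Acc; acc)
open import Data.Fin using (Fin; zero; suc; toℕ; cast; combine; remQuot; finToFun; funToFin)
import Data.Fin as Fin
import Data.Fin.Properties as Fin
open import Data.List using (List; []; _∷_; length; map; mapMaybe; lookup; deduplicate; allFin; cartesianProduct)
open import Data.List.Properties using (length-map; length-tabulate; map-∘; map-cong)
open import Data.List.Membership.Propositional using (_∈_)
open import Data.List.Membership.Propositional.Properties
  using (∈-lookup; ∈-allFin; ∈-map⁺; ∈-map⁻; ∈-deduplicate⁺; ∈-deduplicate⁻)
import Data.List.Membership.Setoid.Properties as Membership
open import Data.List.Relation.Unary.All using (All; []; _∷_)
import Data.List.Relation.Unary.All as All
open import Data.List.Relation.Unary.All.Properties using (¬Any⇒All¬)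
open import Data.List.Relation.Unary.AllPairs using ([]; _∷_)
open import Data.List.Relation.Unary.Any using (here; there; index)
open import Data.List.Relation.Unary.Unique.Propositional using (Unique)
import Data.List.Relation.Unary.Unique.DecPropositional as DecUnique
import Data.List.Relation.Unary.Unique.DecPropositional.Properties as DecUnique
import Data.List.Membership.DecPropositional as DecMembership
import Data.Maybe as Maybe
open import Data.Product using (∃; ∃₂; _×_; _,_; proj₁; proj₂)
open import Data.Sum using (_⊎_; inj₁; inj₂)
open import Data.Empty using (⊥-elim)
open import Function using (_∘_)
open import Relation.Binary using (Rel; Decidable; Symmetric)
open import Relation.Binary.Construct.Closure.ReflexiveTransitive using (Star; ε; _◅_)
open import Relation.Binary.PropositionalEquality
  using (_≡_; _≢_; refl; sym; trans; cong; cong₂; subst; setoid)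
open import Relation.Nullary using (¬_; Dec; yes; no; _×-dec_; _→-dec_; ¬?)
open import Relation.Nullary.Decidable using (map′; dec⇒maybe)

-- Finite simple connected graphs.  The edge uv is given by Adj in both
-- directions, and `Star Adj u v` is the type of walks from u to v.

record Graph : Set₁ where
  field
    order      : ℕ
  V : Set
  V = Fin order
  field
    Adj        : Rel V 0ℓ
    adj?       : Decidable Adj
    adj-sym    : Symmetric Adj
    adj-irrefl : ∀ {u} → ¬ Adj u u
    connected  : ∀ u v → Star Adj u v

-- Edges in positions i < j of a path, with colours listed in cs, have
-- j ∸ (i + 1) edges strictly in between.

Proper : ℕ → List ℕ → Set
Proper ℓ cs = ∀ (i j : Fin (length cs)) → i Fin.< j →
  toℕ j ∸ suc (toℕ i) < ℓ → lookup cs i ≢ lookup cs j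

module _ (G : Graph) where
  open Graph G

  vertices : ∀ {u v} → Star Adj u v → List V
  vertices {u} ε       = u ∷ []
  vertices {u} (_ ◅ p) = u ∷ vertices p

  IsPath : ∀ {u v} → Star Adj u v → Set
  IsPath p = Unique (vertices p)

  Traceable : Set
  Traceable = ∃₂ λ u v → ∃ λ (p : Star Adj u v) → IsPath p × (∀ x → x ∈ vertices p)

  -- `colour-sym` makes the colour depend only on the unordered pair of ends:
  -- neither on the direction nor on the proof of adjacency.

  record EdgeColouring : Set where
    field
      colour     : ∀ {u v} → Adj u v → ℕ
      colour-sym : ∀ {u v} (a : Adj u v) (b : Adj v u) → colour a ≡ colour b

  open EdgeColouring

  colours : ∀ {u v} → EdgeColouring → Star Adj u v → List ℕ
  colours c ε       = []
  colours c (a ◅ p) = colour c a ∷ colours c p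

  IsProperPath : ℕ → EdgeColouring → ∀ {u v} → Star Adj u v → Set
  IsProperPath ℓ c p = IsPath p × Proper ℓ (colours c p)

  ProperConnected : ℕ → EdgeColouring → Set
  ProperConnected ℓ c = ∀ u v → u ≢ v → ∃ λ (p : Star Adj u v) → IsProperPath ℓ c p

  -- Every edge occurs twice, once in each direction.

  arcs : List (∃₂ Adj)
  arcs = mapMaybe (λ (u , v) → Maybe.map (λ a → u , v , a) (dec⇒maybe (adj? u v)))
                  (cartesianProduct (allFin order) (allFin order))

  arcColour : EdgeColouring → ∃₂ Adj → ℕ
  arcColour c (_ , _ , a) = colour c a

  numColours : EdgeColouring → ℕ
  numColours c = length (deduplicate _≟_ (map (arcColour c) arcs))

  IsPC₁ : ℕ → ℕ → Set
  IsPC₁ ℓ k = (∃ λ c → ProperConnected ℓ c × numColours c ≡ k)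
            × (∀ c → ProperConnected ℓ c → k ≤ numColours c)

-- The rest of the module shows that the minimum is attained for every graph
-- (`pc₁-exists`), so that it defines a natural number `pc₁`.

private

  lookup-injective : ∀ {A : Set} {xs : List A} → Unique xs →
    ∀ {i j} → lookup xs i ≡ lookup xs j → i ≡ j
  lookup-injective (_ ∷ _)  {zero}  {zero}  _  = refl
  lookup-injective (x ∷ _)  {zero}  {suc j} eq = ⊥-elim (All.lookup x (∈-lookup j) eq)
  lookup-injective (x ∷ _)  {suc i} {zero}  eq = ⊥-elim (All.lookup x (∈-lookup i) (sym eq))
  lookup-injective (_ ∷ xs) {suc i} {suc j} eq = cong suc (lookup-injective xs eq)

  unique-⊆-length : ∀ {A : Set} {xs ys : List A} → Unique xs →
    (∀ {x} → x ∈ xs → x ∈ ys) → length xs ≤ length ys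
  unique-⊆-length {A} {xs} {ys} u sub = Fin.injective⇒≤ {f = f} f-inj
    where
    f : Fin (length xs) → Fin (length ys)
    f i = index (sub (∈-lookup {xs = xs} i))
    f-inj : ∀ {i j} → f i ≡ f j → i ≡ j
    f-inj {i} {j} eq = lookup-injective u
      (Membership.index-injective (setoid A) (sub (∈-lookup i)) (sub (∈-lookup j)) eq)

  length-deduplicate-map : ∀ (r : ℕ → ℕ) xs →
    length (deduplicate _≟_ (map r xs)) ≤ length (deduplicate _≟_ xs)
  length-deduplicate-map r xs = subst (length (deduplicate _≟_ (map r xs)) ≤_)
    (length-map r (deduplicate _≟_ xs))
    (unique-⊆-length (DecUnique.deduplicate-! _≟_ (map r xs)) sub)
    where
    sub : ∀ {x} → x ∈ deduplicate _≟_ (map r xs) → x ∈ map r (deduplicate _≟_ xs)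
    sub x∈ with ∈-map⁻ r (∈-deduplicate⁻ _≟_ (map r xs) x∈)
    ... | y , y∈ , refl = ∈-map⁺ r (∈-deduplicate⁺ _≟_ y∈)

  proper? : ∀ ℓ cs → Dec (Proper ℓ cs)
  proper? ℓ cs = Fin.all? λ i → Fin.all? λ j →
    (i Fin.<? j) →-dec ((toℕ j ∸ suc (toℕ i) <? ℓ) →-dec ¬? (lookup cs i ≟ lookup cs j))

  unique⇒proper : ∀ ℓ {cs} → Unique cs → Proper ℓ cs
  unique⇒proper ℓ u i j i<j _ eq = Fin.<⇒≢ i<j (lookup-injective u eq)

  lookup-map : ∀ (r : ℕ → ℕ) cs (i : Fin (length (map r cs))) →
    lookup (map r cs) i ≡ r (lookup cs (cast (length-map r cs) i))
  lookup-map r (c ∷ cs) zero    = refl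
  lookup-map r (c ∷ cs) (suc i) = lookup-map r cs i

  proper-map : ∀ ℓ (r : ℕ → ℕ) cs →
    (∀ {x y} → x ∈ cs → y ∈ cs → r x ≡ r y → x ≡ y) →
    Proper ℓ cs → Proper ℓ (map r cs)
  proper-map ℓ r cs inj pr i j i<j d eq = pr i′ j′
    (subst (_< toℕ j′) (sym ti) (subst (toℕ i <_) (sym tj) i<j))
    (subst (_< ℓ) (sym (cong₂ (λ a b → a ∸ suc b) tj ti)) d)
    (inj (∈-lookup i′) (∈-lookup j′)
      (trans (sym (lookup-map r cs i)) (trans eq (lookup-map r cs j))))
    where
    i′ = cast (length-map r cs) i
    j′ = cast (length-map r cs) j
    ti : toℕ i′ ≡ toℕ i
    ti = Fin.toℕ-cast (length-map r cs) i
    tj : toℕ j′ ≡ toℕ j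
    tj = Fin.toℕ-cast (length-map r cs) j

  least : ∀ {P : ℕ → Set} → (∀ k → Dec (P k)) → ∀ {k} → P k → ∃ λ m → P m × (∀ j → P j → m ≤ j)
  least {P} P? {k} = go k (<-wellFounded k)
    where
    go : ∀ k → Acc _<_ k → P k → ∃ λ m → P m × (∀ j → P j → m ≤ j)
    go k (acc rs) pk with ℕ.anyUpTo? P? k
    ... | yes (j , j<k , pj) = go j (rs j<k) pj
    ... | no  none           = k , pk , λ j pj → ℕ.≮⇒≥ λ j<k → none (j , j<k , pj)

  module Existence (G : Graph) (ℓ : ℕ) where
    open Graph G
    open EdgeColouring

    colour-irr : ∀ (c : EdgeColouring G) {u v} (a b : Adj u v) → colour c a ≡ colour c b
    colour-irr c a b = trans (colour-sym c a (adj-sym a)) (sym (colour-sym c b (adj-sym a)))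

    -- Decidability of proper connection.

    Search : EdgeColouring G → ℕ → V → V → (List V → List ℕ → Set) → Set
    Search c m u v Q = ∃ λ (p : Star Adj u v) →
      length (colours G c p) ≤ m × Q (vertices G p) (colours G c p)

    search? : ∀ c m u v {Q : List V → List ℕ → Set} → (∀ vs cs → Dec (Q vs cs)) → Dec (Search c m u v Q)
    stepSearch? : ∀ c m u v {Q : List V → List ℕ → Set} → (∀ vs cs → Dec (Q vs cs)) →
      Dec (∃ λ w → ∃ λ (a : Adj u w) →
        Search c m w v (λ vs cs → Q (u ∷ vs) (colour c a ∷ cs)))
    nilSearch? : ∀ u v {Q : List V → List ℕ → Set} → (∀ vs cs → Dec (Q vs cs)) →
      Dec (u ≡ v × Q (u ∷ []) [])

    nilSearch? u v Q? = (u Fin.≟ v) ×-dec Q? (u ∷ []) []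

    stepSearch? c m u v {Q} Q? = Fin.any? try
      where
      try : ∀ w → Dec (∃ λ (a : Adj u w) →
        Search c m w v (λ vs cs → Q (u ∷ vs) (colour c a ∷ cs)))
      try w with adj? u w
      ... | no ¬a = no λ (a , _) → ¬a a
      ... | yes a = map′ (a ,_)
        (λ (b , p , l , q) → p , l ,
          subst (λ k → Q (u ∷ vertices G p) (k ∷ colours G c p)) (colour-irr c b a) q)
        (search? c m w v {λ vs cs → Q (u ∷ vs) (colour c a ∷ cs)} (λ vs cs → Q? (u ∷ vs) (colour c a ∷ cs)))

    search? c zero u v {Q} Q? with nilSearch? u v {Q} Q?
    ... | yes (refl , q) = yes (ε , z≤n , q)
    ... | no ¬q = no λ { (ε , _ , q) → ¬q (refl , q) ; (_ ◅ _ , () , _) }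
    search? c (suc m) u v {Q} Q? with nilSearch? u v {Q} Q? | stepSearch? c m u v {Q} Q?
    ... | yes (refl , q) | _ = yes (ε , z≤n , q)
    ... | no ¬q | yes (w , a , p , l , q) = yes (a ◅ p , s≤s l , q)
    ... | no ¬q | no ¬s = no λ
      { (ε , _ , q) → ¬q (refl , q)
      ; (a ◅ p , s≤s l , q) → ¬s (_ , a , p , l , q) }

    length-colours : ∀ c {u v} (p : Star Adj u v) →
      length (vertices G p) ≡ suc (length (colours G c p))
    length-colours c ε       = refl
    length-colours c (_ ◅ p) = cong suc (length-colours c p)

    path-bound : ∀ c {u v} (p : Star Adj u v) → IsPath G p → length (colours G c p) ≤ order
    path-bound c p u = ℕ.≤-trans (ℕ.n≤1+n _)
      (ℕ.≤-trans (ℕ.≤-reflexive (sym (length-colours c p)))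
        (subst (length (vertices G p) ≤_) (length-allFin order)
          (unique-⊆-length u (λ {x} _ → ∈-allFin x))))
      where
      length-allFin : ∀ n → length (allFin n) ≡ n
      length-allFin n = length-tabulate {n = n} (λ i → i)

    properConnected? : ∀ c → Dec (ProperConnected G ℓ c)
    properConnected? c = Fin.all? λ u → Fin.all? λ v → ¬? (u Fin.≟ v) →-dec
      map′ (λ (p , _ , q) → p , q) (λ (p , q) → p , path-bound c p (proj₁ q) , q)
        (search? c order u v {λ vs cs → Unique vs × Proper ℓ cs} (λ vs cs → DecUnique.unique? Fin._≟_ vs ×-dec proper? ℓ cs))

    -- Only finitely many colourings matter: those coded by functions on the
    -- pairs of vertices with values among the pairs (and one default value).

    pairs : ℕ
    pairs = order * order

    decode : (Fin pairs → Fin (suc pairs)) → EdgeColouring G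
    decode f .colour     {u} {v} _   = toℕ (f (combine u v)) ⊔ toℕ (f (combine v u))
    decode f .colour-sym {u} {v} _ _ = ℕ.⊔-comm (toℕ (f (combine u v))) (toℕ (f (combine v u)))

    module Rename (c : EdgeColouring G) where

      HasColour : ℕ → V → V → Set
      HasColour k u v = ∃ λ (a : Adj u v) → colour c a ≡ k

      hasColour? : ∀ k u v → Dec (HasColour k u v)
      hasColour? k u v with adj? u v
      ... | no ¬a = no λ (a , _) → ¬a a
      ... | yes a = map′ (a ,_) (λ (b , e) → trans (colour-irr c a b) e) (colour c a ≟ k)

      occurs? : ∀ k → Dec (∃₂ (HasColour k))
      occurs? k = Fin.any? λ u → Fin.any? λ v → hasColour? k u v

      code : ∀ {k} → Dec (∃₂ (HasColour k)) → Fin (suc pairs)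
      code (yes (u , v , _)) = suc (combine u v)
      code (no _)            = zero

      rename : ℕ → Fin (suc pairs)
      rename k = code (occurs? k)

      code-inj : ∀ {k k′} (d : Dec (∃₂ (HasColour k))) (d′ : Dec (∃₂ (HasColour k′))) →
        ∃₂ (HasColour k) → ∃₂ (HasColour k′) → code d ≡ code d′ → k ≡ k′
      code-inj (no ¬o) _ o _ _ = ⊥-elim (¬o o)
      code-inj (yes _) (no ¬o) _ o _ = ⊥-elim (¬o o)
      code-inj (yes (u , v , a , e)) (yes (u′ , v′ , a′ , e′)) _ _ eq
        with Fin.combine-injective u v u′ v′ (Fin.suc-injective eq)
      ... | refl , refl = trans (sym e) (trans (colour-irr c a a′) e′)

      table : V → V → Fin (suc pairs)
      table u v with adj? u v
      ... | yes a = rename (colour c a)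
      ... | no _  = zero

      table-adj : ∀ {u v} (a : Adj u v) → table u v ≡ rename (colour c a)
      table-adj {u} {v} a with adj? u v
      ... | yes b = cong rename (colour-irr c b a)
      ... | no ¬b = ⊥-elim (¬b a)

      x : Fin (suc pairs ^ pairs)
      x = funToFin (λ e → table (proj₁ (remQuot order e)) (proj₂ (remQuot {order} order e)))

      x-table : ∀ u v → finToFun x (combine u v) ≡ table u v
      x-table u v = trans (Fin.finToFun-funToFin {pairs} _ (combine u v))
        (cong (λ (s , t) → table s t) (Fin.remQuot-combine u v))

      r : ℕ → ℕ
      r k = toℕ (rename k)

      c′ : EdgeColouring G
      c′ = decode (finToFun x)

      colour-c′ : ∀ {u v} (a : Adj u v) → colour c′ a ≡ r (colour c a)
      colour-c′ {u} {v} a = trans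
        (cong₂ (λ s t → toℕ s ⊔ toℕ t)
          (trans (x-table u v) (table-adj a))
          (trans (x-table v u) (trans (table-adj (adj-sym a))
            (cong rename (sym (colour-sym c a (adj-sym a)))))))
        (ℕ.⊔-idem (r (colour c a)))

      colours-c′ : ∀ {u v} (p : Star Adj u v) → colours G c′ p ≡ map r (colours G c p)
      colours-c′ ε       = refl
      colours-c′ (a ◅ p) = cong₂ _∷_ (colour-c′ a) (colours-c′ p)

      occurs : ∀ {u v k} (p : Star Adj u v) → k ∈ colours G c p → ∃₂ (HasColour k)
      occurs (a ◅ p) (here refl) = _ , _ , a , refl
      occurs (a ◅ p) (there k∈)  = occurs p k∈

      connected′ : ProperConnected G ℓ c → ProperConnected G ℓ c′
      connected′ good u v u≢v with good u v u≢v
      ... | p , path , pr = p , path , subst (Proper ℓ) (sym (colours-c′ p))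
        (proper-map ℓ r (colours G c p)
          (λ {k} {k′} k∈ k′∈ eq → code-inj (occurs? k) (occurs? k′)
            (occurs p k∈) (occurs p k′∈) (Fin.toℕ-injective eq))
          pr)

      numColours′ : numColours G c′ ≤ numColours G c
      numColours′ = subst (_≤ numColours G c)
        (cong (length ∘ deduplicate _≟_)
          (trans (sym (map-∘ (arcs G))) (map-cong (λ (_ , _ , a) → sym (colour-c′ a)) (arcs G))))
        (length-deduplicate-map r (map (arcColour G c) (arcs G)))

    -- A rainbow colouring is always properly connected.

    rainbow : EdgeColouring G
    rainbow .colour     {u} {v} _   = toℕ (combine u v) ⊔ toℕ (combine v u)
    rainbow .colour-sym {u} {v} _ _ = ℕ.⊔-comm (toℕ (combine u v)) (toℕ (combine v u))

    rainbow-fst : ∀ {u v s t : V} →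
      toℕ (combine u v) ⊔ toℕ (combine v u) ≡ toℕ (combine s t) ⊔ toℕ (combine t s) →
      u ≡ s ⊎ u ≡ t
    rainbow-fst {u} {v} {s} {t} eq
      with ℕ.⊔-sel (toℕ (combine u v)) (toℕ (combine v u))
         | ℕ.⊔-sel (toℕ (combine s t)) (toℕ (combine t s))
    ... | inj₁ p | inj₁ q = inj₁ (Fin.combine-injectiveˡ u v s t
          (Fin.toℕ-injective (trans (sym p) (trans eq q))))
    ... | inj₁ p | inj₂ q = inj₂ (Fin.combine-injectiveˡ u v t s
          (Fin.toℕ-injective (trans (sym p) (trans eq q))))
    ... | inj₂ p | inj₁ q = inj₂ (Fin.combine-injectiveʳ v u s t
          (Fin.toℕ-injective (trans (sym p) (trans eq q))))
    ... | inj₂ p | inj₂ q = inj₁ (Fin.combine-injectiveʳ v u t s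
          (Fin.toℕ-injective (trans (sym p) (trans eq q))))

    start∈ : ∀ {u v} (p : Star Adj u v) → u ∈ vertices G p
    start∈ ε       = here refl
    start∈ (_ ◅ _) = here refl

    rainbow-fresh : ∀ {u w s t} (a : Adj u w) (p : Star Adj s t) →
      All (u ≢_) (vertices G p) → All (colour rainbow a ≢_) (colours G rainbow p)
    rainbow-fresh a ε       _         = []
    rainbow-fresh {u} {w} a (_◅_ {i} {j} b p) (≢i ∷ ≢p) = ≢b ∷ rainbow-fresh a p ≢p
      where
      ≢b : colour rainbow a ≢ colour rainbow b
      ≢b eq with rainbow-fst {u} {w} {i} {j} eq
      ... | inj₁ u≡i = ≢i u≡i
      ... | inj₂ u≡j = All.lookup ≢p (start∈ p) u≡j

    rainbow-unique : ∀ {u v} (p : Star Adj u v) → IsPath G p → Unique (colours G rainbow p)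
    rainbow-unique ε       _         = []
    rainbow-unique (a ◅ p) (≢p ∷ up) = rainbow-fresh a p ≢p ∷ rainbow-unique p up

    suffix : ∀ {u v w} (p : Star Adj u v) → IsPath G p → w ∈ vertices G p →
      ∃ λ (q : Star Adj w v) → IsPath G q
    suffix ε       up       (here refl) = ε , up
    suffix (a ◅ p) up       (here refl) = a ◅ p , up
    suffix (a ◅ p) (_ ∷ up) (there w∈)  = suffix p up w∈

    toPath : ∀ {u v} → Star Adj u v → ∃ λ (q : Star Adj u v) → IsPath G q
    toPath ε = ε , [] ∷ []
    toPath {u} (a ◅ p) with toPath p
    ... | q , uq with DecMembership._∈?_ Fin._≟_ u (vertices G q)
    ...   | yes u∈ = suffix q uq u∈
    ...   | no  u∉ = a ◅ q , ¬Any⇒All¬ _ u∉ ∷ uq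

    rainbow-connected : ProperConnected G ℓ rainbow
    rainbow-connected u v _ with toPath (connected u v)
    ... | q , uq = q , uq , unique⇒proper ℓ (rainbow-unique q uq)

    Attained : ℕ → Set
    Attained k = ∃ λ (x : Fin (suc pairs ^ pairs)) →
      ProperConnected G ℓ (decode (finToFun x)) × numColours G (decode (finToFun x)) ≡ k

    attained? : ∀ k → Dec (Attained k)
    attained? k = Fin.any? λ x →
      properConnected? (decode (finToFun x)) ×-dec (numColours G (decode (finToFun x)) ≟ k)

    attained : ∀ c → ProperConnected G ℓ c → Attained (numColours G (Rename.c′ c))
    attained c good = Rename.x c , Rename.connected′ c good , refl

    exists : ∃ (IsPC₁ G ℓ)
    exists with least attained? (attained rainbow rainbow-connected)
    ... | m , (x , good , eq) , min = m , (decode (finToFun x) , good , eq) ,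
      λ c good′ → ℕ.≤-trans (min _ (attained c good′)) (Rename.numColours′ c)

pc₁-exists : ∀ G ℓ → ∃ (IsPC₁ G ℓ)
pc₁-exists G ℓ = Existence.exists G ℓ

pc₁ : Graph → ℕ → ℕ
pc₁ G ℓ = proj₁ (pc₁-exists G ℓ)

pc₁-isPC₁ : ∀ G ℓ → IsPC₁ G ℓ (pc₁ G ℓ)
pc₁-isPC₁ G ℓ = proj₂ (pc₁-exists G ℓ)

{-# OPTIONS --safe #-}

-- Number the vertices along a Hamiltonian path and colour every edge of the
-- graph, on the path or not, by the smaller number of its ends modulo ℓ + 1.
-- Two distinct vertices are joined by a segment of the Hamiltonian path, whose
-- edges carry consecutive residues; equal colours on it are therefore at
-- least ℓ + 1 positions apart.

module Submission where

open import Defs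
open import Axiom.UniquenessOfIdentityProofs using (module Decidable⇒UIP)
open import Data.Nat using (ℕ; suc; _+_; _∸_; _*_; _⊓_; _≤_; _<_; _>_; s≤s; NonZero; _≟_)
open import Data.Nat.Properties
open import Data.Nat.DivMod using (_/_; _%_; m≡m%n+[m/n]*n; m%n<n)
open import Data.Nat.Divisibility using (_∣_; ∣m+n∣m⇒∣n; ∣⇒≤; n∣m*n)
open import Data.Fin using (Fin; zero; suc; toℕ; fromℕ<)
import Data.Fin.Properties as Fin
open import Data.List using (List; length; lookup; deduplicate; map)
open import Data.List.Membership.Propositional using (_∈_)
open import Data.List.Membership.Propositional.Properties using (∈-lookup; ∈-map⁻; ∈-deduplicate⁻)
import Data.List.Membership.Setoid.Properties as Membership
open import Data.List.Relation.Unary.All as All using (All; []; _∷_)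
open import Data.List.Relation.Unary.AllPairs as AllPairs using (AllPairs; []; _∷_)
open import Data.List.Relation.Unary.Any using (here; there; index)
open import Data.List.Relation.Unary.Unique.Propositional using (Unique)
open import Data.List.Relation.Unary.Unique.DecPropositional.Properties using (deduplicate-!)
open import Data.Product using (∃; _×_; _,_; proj₁; proj₂)
open import Data.Sum using (_⊎_; inj₁; inj₂)
open import Function using (_∘_; _on_)
open import Level using (0ℓ)
open import Relation.Binary using (Rel; Transitive; _⇒_)
open import Relation.Binary.Construct.Closure.ReflexiveTransitive as Star using (Star; ε; _◅_)
open import Relation.Binary.PropositionalEquality
open import Relation.Nullary using (¬_; contradiction)

-- Cancelling equal remainders from the two division identities leaves `a / m * m + d` equal to a
-- multiple of `m`. Then `m` divides `d`, which is impossible for `0 < d < m`.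
%-shift-≢ : ∀ {m} .{{_ : NonZero m}} a {d} .{{_ : NonZero d}} → d < m → a % m ≢ (a + d) % m
%-shift-≢ {m} a {d} d<m eq = <⇒≱ d<m (∣⇒≤ (∣m+n∣m⇒∣n m∣q*m+d (n∣m*n (a / m))))
  where
  open ≡-Reasoning
  q*m+d≡q′*m : a / m * m + d ≡ (a + d) / m * m
  q*m+d≡q′*m = +-cancelˡ-≡ (a % m) _ _ (begin
    a % m + (a / m * m + d)             ≡⟨ +-assoc (a % m) _ d ⟨
    a % m + a / m * m + d               ≡⟨ cong (_+ d) (m≡m%n+[m/n]*n a m) ⟨
    a + d                               ≡⟨ m≡m%n+[m/n]*n (a + d) m ⟩
    (a + d) % m + (a + d) / m * m       ≡⟨ cong (_+ (a + d) / m * m) eq ⟨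
    a % m + (a + d) / m * m             ∎)
  m∣q*m+d = subst (m ∣_) (sym q*m+d≡q′*m) (n∣m*n ((a + d) / m))

-- Here `e` lists the colours before reduction modulo `ℓ + 1`. The disjunction in the last
-- hypothesis covers lists that run upwards and lists that run downwards.
proper-residues : ∀ ℓ cs (e : Fin (length cs) → ℕ) → (∀ i → lookup cs i ≡ e i % suc ℓ) →
  (∀ i j d → toℕ i + d ≡ toℕ j → e j ≡ e i + d ⊎ e i ≡ e j + d) → Proper ℓ cs
proper-residues ℓ cs e cs≡e step i j i<j gap<ℓ eq
  -- With `g` edges strictly between, the positions differ by `g + 1`: a nonzero shift, and below
  -- `ℓ + 1` because `g < ℓ`.
  with step i j (suc (toℕ j ∸ suc (toℕ i))) (trans (+-suc (toℕ i) _) (m+[n∸m]≡n i<j))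
... | inj₁ up = %-shift-≢ (e i) (s≤s gap<ℓ)
      (trans (sym (cs≡e i)) (trans eq (trans (cs≡e j) (cong (_% suc ℓ) up))))
... | inj₂ down = %-shift-≢ (e j) (s≤s gap<ℓ)
      (trans (sym (cs≡e j)) (trans (sym eq) (trans (cs≡e i) (cong (_% suc ℓ) down))))

unique⇒lookup-injective : ∀ {A : Set} {xs : List A} → Unique xs →
  ∀ i j → lookup xs i ≡ lookup xs j → i ≡ j
unique⇒lookup-injective (_  ∷ _) zero    zero    _  = refl
unique⇒lookup-injective (≢s ∷ _) zero    (suc j) eq = contradiction eq (All.lookup ≢s (∈-lookup j))
unique⇒lookup-injective (≢s ∷ _) (suc i) zero    eq = contradiction (sym eq) (All.lookup ≢s (∈-lookup i))
unique⇒lookup-injective (_  ∷ u) (suc i) (suc j) eq = cong suc (unique⇒lookup-injective u i j eq)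

-- Pigeonhole: distinct entries make the map from positions to `Fin n` injective.
unique-bounded⇒length≤ : ∀ {n xs} → Unique xs → All (_< n) xs → length xs ≤ n
unique-bounded⇒length≤ {n} {xs} u xs<n = Fin.injective⇒≤ {f = λ i → fromℕ< (bound i)}
  λ {i} {j} eq → unique⇒lookup-injective u i j (Fin.fromℕ<-injective _ _ (bound i) (bound j) eq)
  where
  bound : ∀ i → lookup xs i < n
  bound i = All.lookup xs<n (∈-lookup i)

module _ (G : Graph) where
  open Graph G
  open EdgeColouring

  -- By transitivity each vertex precedes all later ones, and irreflexivity then makes them
  -- distinct. The order will be `<` or `>` on vertex numbers.
  increasing⇒isPath : ∀ {T : Rel V 0ℓ} (_≺_ : Rel V 0ℓ) → Transitive _≺_ → (∀ {u} → ¬ u ≺ u) →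
    (T⇒Adj : T ⇒ Adj) → T ⇒ _≺_ → ∀ {u v} (q : Star T u v) → IsPath G (Star.map T⇒Adj q)
  increasing⇒isPath {T} _≺_ ≺-trans ≺-irrefl T⇒Adj T⇒≺ =
    AllPairs.map (λ { u≺v refl → ≺-irrefl u≺v }) ∘ increasing
    where
    above : ∀ {t u v} (q : Star T u v) → t ≺ u → All (t ≺_) (vertices G (Star.map T⇒Adj q))
    above ε       t≺u = t≺u ∷ []
    above (s ◅ q) t≺u = t≺u ∷ above q (≺-trans t≺u (T⇒≺ s))
    increasing : ∀ {u v} (q : Star T u v) → AllPairs _≺_ (vertices G (Star.map T⇒Adj q))
    increasing ε       = [] ∷ []
    increasing (s ◅ q) = above q (T⇒≺ s) ∷ increasing q

  module _ (f : V → ℕ) where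

    -- Each step carries its adjacency together with the change in number, so that reversing a walk
    -- of `Up` steps yields a walk of `Down` steps.
    Up Down : Rel V 0ℓ
    Up   u v = Adj u v × f v ≡ suc (f u)
    Down u v = Adj u v × f u ≡ suc (f v)

    module _ (ℓ : ℕ) where

      residueColouring : EdgeColouring G
      residueColouring .colour     {u} {v} _   = (f u ⊓ f v) % suc ℓ
      residueColouring .colour-sym {u} {v} _ _ = cong (_% suc ℓ) (⊓-comm (f u) (f v))

      numColours-residueColouring : numColours G residueColouring ≤ suc ℓ
      numColours-residueColouring =
        unique-bounded⇒length≤ (deduplicate-! _≟_ cs) (All.tabulate (bound ∘ ∈-deduplicate⁻ _≟_ cs))
        where
        cs : List ℕ
        cs = map (arcColour G residueColouring) (arcs G)
        bound : ∀ {k} → k ∈ cs → k < suc ℓ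
        bound k∈ with ∈-map⁻ (arcColour G residueColouring) k∈
        ... | (u , v , _) , _ , refl = m%n<n (f u ⊓ f v) (suc ℓ)

      residues : ∀ {P : Rel V 0ℓ} {u v} → Star (λ x y → Adj x y × P x y) u v → List ℕ
      residues q = colours G residueColouring (Star.map proj₁ q)

      colours-up : ∀ {u v} (q : Star Up u v) (i : Fin (length (residues q))) →
        lookup (residues q) i ≡ (f u + toℕ i) % suc ℓ
      colours-up {u} ((_ , fw) ◅ q) zero = cong (_% suc ℓ)
        (trans (m≤n⇒m⊓n≡m (≤-trans (n≤1+n _) (≤-reflexive (sym fw)))) (sym (+-identityʳ (f u))))
      colours-up {u} ((_ , fw) ◅ q) (suc i) = trans (colours-up q i)
        (cong (_% suc ℓ) (trans (cong (_+ toℕ i) fw) (sym (+-suc (f u) (toℕ i)))))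

      -- On a descending walk the smaller end of edge `i` is its far end, numbered `f u - (i + 1)`.
      -- Giving this number through a sum avoids truncated subtraction.
      colours-down : ∀ {u v} (q : Star Down u v) (i : Fin (length (residues q))) →
        ∃ λ e → lookup (residues q) i ≡ e % suc ℓ × e + suc (toℕ i) ≡ f u
      colours-down (_◅_ {j = w} (_ , fu) q) zero = f w ,
        cong (_% suc ℓ) (m≥n⇒m⊓n≡n (≤-trans (n≤1+n _) (≤-reflexive (sym fu)))) ,
        trans (+-comm (f w) 1) (sym fu)
      colours-down ((_ , fu) ◅ q) (suc i) with colours-down q i
      ... | e , eq , e+i = e , eq , trans (+-suc e _) (trans (cong suc e+i) (sym fu))

      up-proper : ∀ {u v} (q : Star Up u v) → IsProperPath G ℓ residueColouring (Star.map proj₁ q)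
      up-proper {u} q =
        increasing⇒isPath (_<_ on f) <-trans (<-irrefl refl) proj₁ (≤-reflexive ∘ sym ∘ proj₂) q ,
        proper-residues ℓ (residues q) (λ i → f u + toℕ i) (colours-up q)
          (λ i j d i+d≡j → inj₁ (trans (cong (f u +_) (sym i+d≡j)) (sym (+-assoc (f u) (toℕ i) d))))

      down-proper : ∀ {u v} (q : Star Down u v) → IsProperPath G ℓ residueColouring (Star.map proj₁ q)
      down-proper {u} q =
        increasing⇒isPath (_>_ on f) (λ x>y y>z → <-trans y>z x>y) (<-irrefl refl) proj₁
          (≤-reflexive ∘ sym ∘ proj₂) q ,
        proper-residues ℓ (residues q) e (proj₁ ∘ proj₂ ∘ colours-down q) (λ i j d → inj₂ ∘ shift i j d)
        where
        e = proj₁ ∘ colours-down q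
        e+1+i≡fu = proj₂ ∘ proj₂ ∘ colours-down q
        open ≡-Reasoning
        shift : ∀ i j d → toℕ i + d ≡ toℕ j → e i ≡ e j + d
        shift i j d i+d≡j = +-cancelʳ-≡ (suc (toℕ i)) _ _ (begin
          e i + suc (toℕ i)         ≡⟨ trans (e+1+i≡fu i) (sym (e+1+i≡fu j)) ⟩
          e j + suc (toℕ j)         ≡⟨ cong (λ k → e j + suc k) (trans (sym i+d≡j) (+-comm (toℕ i) d)) ⟩
          e j + suc (d + toℕ i)     ≡⟨ cong (e j +_) (+-suc d (toℕ i)) ⟨
          e j + (d + suc (toℕ i))   ≡⟨ +-assoc (e j) d _ ⟨
          e j + d + suc (toℕ i)     ∎)

    -- The offset `k` allows induction on the walk: passing to the tail raises it by one.
    Numbers : ∀ {u v} → ℕ → Star Adj u v → Set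
    Numbers k p = ∀ {x} (x∈ : x ∈ vertices G p) → f x ≡ k + toℕ (index x∈)

    numbers-start : ∀ {k u v} (p : Star Adj u v) → Numbers k p → f u ≡ k
    numbers-start {k} ε       num = trans (num (here refl)) (+-identityʳ k)
    numbers-start {k} (_ ◅ _) num = trans (num (here refl)) (+-identityʳ k)

    numbers-tail : ∀ {k u w v} (a : Adj u w) (p : Star Adj w v) → Numbers k (a ◅ p) → Numbers (suc k) p
    numbers-tail {k} a p num x∈ = trans (num (there x∈)) (+-suc k _)

    up-to : ∀ {k u v x} (p : Star Adj u v) → Numbers k p → x ∈ vertices G p → Star Up u x
    up-to ε       num (here refl) = ε
    up-to (a ◅ p) num (here refl) = ε
    up-to (a ◅ p) num (there x∈)  =
      (a , trans (numbers-start p num′) (cong suc (sym (numbers-start (a ◅ p) num)))) ◅ up-to p num′ x∈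
      where num′ = numbers-tail a p num

    -- Initial vertices are dropped until one of `x` and `y` comes first; whichever does starts the
    -- segment supplied by `up-to`.
    up-between : ∀ {k u v x y} (p : Star Adj u v) → Numbers k p →
      x ∈ vertices G p → y ∈ vertices G p → Star Up x y ⊎ Star Up y x
    up-between ε       num (here refl) (here refl) = inj₁ ε
    up-between (a ◅ p) num (here refl) y∈          = inj₁ (up-to (a ◅ p) num y∈)
    up-between (a ◅ p) num (there x∈)  (here refl) = inj₂ (up-to (a ◅ p) num (there x∈))
    up-between (a ◅ p) num (there x∈)  (there y∈)  = up-between p (numbers-tail a p num) x∈ y∈

  pc₁-traceable : Traceable G → ∀ ℓ → pc₁ G ℓ ≤ suc ℓ
  pc₁-traceable (_ , _ , p , path , visits) ℓ =
    ≤-trans (proj₂ (pc₁-isPC₁ G ℓ) (residueColouring f ℓ) connect) (numColours-residueColouring f ℓ)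
    where
    f : V → ℕ
    f x = toℕ (index (visits x))
    numbers : Numbers f 0 p
    -- `f` reads positions from the membership proofs in `visits`, while `Numbers` concerns
    -- arbitrary ones. They agree since a path meets each vertex only once.
    numbers {x} x∈ = cong (toℕ ∘ index)
      (Membership.unique⇒irrelevant (setoid V) (Decidable⇒UIP.≡-irrelevant Fin._≟_) path (visits x) x∈)
    connect : ProperConnected G ℓ (residueColouring f ℓ)
    connect u v _ with up-between f p numbers (visits u) (visits v)
    ... | inj₁ q = Star.map proj₁ q , up-proper f ℓ q
    -- Here `v` precedes `u` on the Hamiltonian path, so the segment is traversed backwards.
    ... | inj₂ q = Star.map proj₁ q′ , down-proper f ℓ q′
      where q′ = Star.reverse (λ (a , eq) → adj-sym a , eq) q

proposition2p3 : (G : Graph) → Traceable G →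
    ((ℓ : ℕ) → .{{_ : NonZero ℓ}} → pc₁ G ℓ ≤ ℓ + 1) × (pc₁ G 2 ≤ 3)
proposition2p3 G t =
  (λ ℓ → subst (pc₁ G ℓ ≤_) (+-comm 1 ℓ) (pc₁-traceable G t ℓ)) , pc₁-traceable G t 2
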